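{- For all integers $r\ge 2$ and $p\ge (2r-1)r+2(r-1)$, we have $C_r(n,K_p^{(r)})=\Omega\left(n^{\frac{r}{r+1}}\right)$ as $n\to\infty$.
   Context: An $r$-graph is an $r$-uniform hypergraph; $K_n^{(r)}$ is the complete $r$-graph on $n$ vertices. For an $r$-graph $H$, an $(n,r,H)$-local coloring with $k$ colors is a family of $n$ edge-colorings $f_v:E(K_n^{(r)})\to[k]$, one for each vertex $v$ of $K_n^{(r)}$, such that for every copy $T$ of $H$ in $K_n^{(r)}$ there is a vertex $u\in V(T)$ for which $f_u$ is rainbow on $T$ (no two edges of $T$ get the same color under $f_u$). $C_r(n,H)$ is the minimum such $k$. -}

module Defs where

open import Data.Nat using (ℕ; _*_; _^_; _≤_)
open import Data.Fin using (Fin)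
open import Data.Fin.Subset using (Subset; _∈_; _⊆_; ∣_∣)
open import Data.Product using (Σ; _×_; ∃)
open import Relation.Binary.PropositionalEquality using (_≡_)

IsEdge : {n : ℕ} → ℕ → Subset n → Set
IsEdge r e = ∣ e ∣ ≡ r

-- An edge-coloring of K_n^{(r)} with k colors (values on non-r-subsets are irrelevant).
EdgeColoring : ℕ → ℕ → Set
EdgeColoring n k = Subset n → Fin k

Rainbow : {n k : ℕ} → ℕ → EdgeColoring n k → Subset n → Set
Rainbow r f T = ∀ e₁ e₂ → IsEdge r e₁ → IsEdge r e₂ → e₁ ⊆ T → e₂ ⊆ T →
                f e₁ ≡ f e₂ → e₁ ≡ e₂

-- An (n, r, K_p^{(r)})-local coloring with k colors.  In K_n^{(r)}, copies of
-- K_p^{(r)} correspond exactly to p-element vertex sets T (with all r-subsets of T).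
IsLocalColoring : (n r p k : ℕ) → (Fin n → EdgeColoring n k) → Set
IsLocalColoring n r p k f =
  ∀ (T : Subset n) → ∣ T ∣ ≡ p → ∃ λ (u : Fin n) → u ∈ T × Rainbow r (f u) T

LocallyColorable : (n r p k : ℕ) → Set
LocallyColorable n r p k = Σ (Fin n → EdgeColoring n k) (IsLocalColoring n r p k)

{-# OPTIONS --safe #-}

-- Write r = t + 2 and split the vertex set into t fixed vertices Q, a set X of 2k
-- vertices, and the rest U.  For u ∈ U the 2k edges Q ∪ {x, u}, x ∈ X, get only k
-- colours under f_u, so double counting yields x ≠ y in X such that
-- f_u (Q ∪ {x, u}) = f_u (Q ∪ {y, u}) for all u in some S ⊆ U with 4k |S| ≥ |U|.
-- Hence f_u repeats a colour on every set containing Q ∪ {x, y, u}, and only the r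
-- vertices v of the hub Q ∪ {x, y} remain to be spoiled.  If S has more than rk
-- edges, then some edge e in S is, for every such v, not the only one of its
-- f_v-colour in S; adding to e one partner per v and padding inside S gives a
-- set of p ≥ r + (r + 1) r vertices on which no f_u is rainbow.  So a local
-- colouring forces (n/k)^r = O(k).
module Submission where

open import Defs
open import Data.Bool using (true; false)
import Data.Empty as Empty
open import Data.Fin using (Fin; zero; suc; _↑ˡ_; _↑ʳ_; _≟_)
open import Data.Fin.Properties using (any?; injective⇒≤)
open import Data.Fin.Subset using (Subset; inside; outside; _∈_; _⊆_; ∣_∣; ⊥; ⊤; ⁅_⁆; _∪_)
open import Data.Fin.Subset.Properties
open import Data.List using (List; []; _∷_; length; filter; map; lookup; allFin; tabulate)
import Data.List as List
open import Data.List.Membership.Propositional using (lose) renaming (_∈_ to _∈ᴸ_)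
open import Data.List.Membership.Propositional.Properties using (∈-lookup; ∈-filter⁻; ∈-map⁻; ∈-allFin; ∈-++⁺ˡ; ∈-++⁺ʳ; ∈-tabulate⁺)
open import Data.List.Properties using (length-map; length-++; length-tabulate; filter-some)
open import Data.List.Relation.Binary.Sublist.Propositional.Properties using (filter-⊆; length-mono-≤) renaming (filter⁺ to filter⁺-⊆)
open import Data.List.Relation.Unary.All as All using (All; []; _∷_)
open import Data.List.Relation.Unary.All.Properties using (all-filter) renaming (map⁺ to All-map⁺; map⁻ to All-map⁻; ++⁺ to All-++⁺)
open import Data.List.Relation.Unary.AllPairs using ([]; _∷_)
open import Data.List.Relation.Unary.Any using (here; there)
open import Data.List.Relation.Unary.Unique.Propositional using (Unique)
open import Data.List.Relation.Unary.Unique.Propositional.Properties using (filter⁺; map⁺; ++⁺; allFin⁺)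
open import Data.Nat using (ℕ; zero; suc; _+_; _*_; _^_; _≤_; _<_; _∸_; z≤n; s≤s; NonZero; >-nonZero)
open import Data.Nat.Combinatorics using (_C_; nCk+nC[k+1]≡[n+1]C[k+1])
open import Data.Nat.ListAction using (sum)
open import Data.Nat.DivMod using (_/_; _%_; m/n*n≤m; m≡m%n+[m/n]*n; m%n<n)
open import Data.Nat.Properties hiding (_≟_)
open import Algebra.Properties.CommutativeSemigroup +-commutativeSemigroup using (x∙yz≈y∙xz)
open import Data.Nat.Tactic.RingSolver using (solve-∀)
open import Data.Product using (∃; ∃₂; _×_; _,_; proj₁; proj₂)
open import Data.Sum using (inj₁; inj₂)
open import Data.Vec using (_∷_; []; _++_; here; there)
import Data.Vec as Vec
open import Data.Vec.Properties using (∷-injectiveʳ; ++-injectiveˡ; ++-injectiveʳ)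
open import Function using (_∘_; id)
open import Relation.Binary.PropositionalEquality
open import Relation.Nullary using (¬_; Dec; yes; no; does; contradiction)
open import Relation.Nullary.Decidable using (¬?; _×-dec_)
open import Relation.Unary using (Decidable)
open import Relation.Unary.Properties using (∁?)

private
  variable
    A X U : Set
    k m n : ℕ

-- Counting in lists

length-allFin : ∀ n → length (allFin n) ≡ n
length-allFin n = length-tabulate {n = n} id

length-filter-∁ : {P : A → Set} (P? : Decidable P) (xs : List A) →
  length xs ≡ length (filter P? xs) + length (filter (∁? P?) xs)
length-filter-∁ P? [] = refl
length-filter-∁ P? (x ∷ xs) with does (P? x)
... | true  = cong suc (length-filter-∁ P? xs)
... | false = trans (cong suc (length-filter-∁ P? xs)) (sym (+-suc _ _))

lookup-injective : {xs : List A} → Unique xs → ∀ {i j} → lookup xs i ≡ lookup xs j → i ≡ j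
lookup-injective (_ ∷ _)   {zero}  {zero}  _  = refl
lookup-injective (x∉ ∷ _)  {zero}  {suc j} eq = contradiction eq (All.lookup x∉ (∈-lookup j))
lookup-injective (x∉ ∷ _)  {suc i} {zero}  eq = contradiction (sym eq) (All.lookup x∉ (∈-lookup i))
lookup-injective (_ ∷ xs!) {suc i} {suc j} eq = cong suc (lookup-injective xs! eq)

Σcount : {R : X → U → Set} → (∀ x u → Dec (R x u)) → List X → List U → ℕ
Σcount R? xs us = sum (map (λ x → length (filter (R? x) us)) xs)

-- Splitting off the column of `u` from a sum taken row by row; iterating this exchanges the order
-- of summation.
Σcount-∷ : {R : X → U → Set} (R? : ∀ x u → Dec (R x u)) (xs : List X) (u : U) (us : List U) →
  Σcount R? xs (u ∷ us) ≡ length (filter (λ x → R? x u) xs) + Σcount R? xs us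
Σcount-∷ R? [] u us = refl
Σcount-∷ R? (x ∷ xs) u us with does (R? x u)
... | true  rewrite Σcount-∷ R? xs u us =
  cong suc (x∙yz≈y∙xz (length (filter (R? x) us)) (length (filter (λ x → R? x u) xs)) (Σcount R? xs us))
... | false rewrite Σcount-∷ R? xs u us =
  x∙yz≈y∙xz (length (filter (R? x) us)) (length (filter (λ x → R? x u) xs)) (Σcount R? xs us)

*≤Σcount : {R : X → U → Set} (R? : ∀ x u → Dec (R x u)) (w : ℕ) (xs : List X) (us : List U) →
  All (λ u → w ≤ length (filter (λ x → R? x u) xs)) us → length us * w ≤ Σcount R? xs us
*≤Σcount R? w xs [] [] = z≤n
*≤Σcount R? w xs (u ∷ us) (w≤ ∷ ws) = begin
  w + length us * w                                       ≤⟨ +-mono-≤ w≤ (*≤Σcount R? w xs us ws) ⟩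
  length (filter (λ x → R? x u) xs) + Σcount R? xs us     ≡⟨ sym (Σcount-∷ R? xs u us) ⟩
  Σcount R? xs (u ∷ us)                                   ∎
  where open ≤-Reasoning

sum≤length*max : (f : A → ℕ) (x : A) (xs : List A) →
  ∃ λ y → sum (map f (x ∷ xs)) ≤ length (x ∷ xs) * f y
sum≤length*max f x [] = x , ≤-refl
sum≤length*max f x (x′ ∷ xs) with sum≤length*max f x′ xs
... | y , s≤ with ≤-total (f x) (f y)
...   | inj₁ fx≤fy = y , +-mono-≤ fx≤fy s≤
...   | inj₂ fy≤fx = x , +-monoʳ-≤ (f x) (≤-trans s≤ (*-monoʳ-≤ (length (x′ ∷ xs)) fy≤fx))

-- Counted by columns there are at least `length us * w` incidences, so the fullest row holds at
-- least the average share. The list `x ∷ xs` is non-empty so that a fullest row exists.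
double-counting : {R : X → U → Set} (R? : ∀ x u → Dec (R x u)) (w : ℕ) (x : X) (xs : List X) (us : List U) →
  All (λ u → w ≤ length (filter (λ x → R? x u) (x ∷ xs))) us →
  ∃ λ y → length us * w ≤ length (x ∷ xs) * length (filter (R? y) us)
double-counting R? w x xs us ws with sum≤length*max (λ y → length (filter (R? y) us)) x xs
... | y , s≤ = y , ≤-trans (*≤Σcount R? w (x ∷ xs) us ws) s≤

-- Pigeonhole

-- The partner `j` ranges over all of `Fin m`, so an index stays twinned when a list containing it
-- is filtered.
Twinned : (Fin m → Fin k) → Fin m → Set
Twinned g i = ∃ λ j → i ≢ j × g i ≡ g j

twinned? : (g : Fin m → Fin k) → Decidable (Twinned g)
twinned? g i = any? λ j → ¬? (i ≟ j) ×-dec (g i ≟ g j)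

-- Two distinct untwinned elements cannot share a colour, so `g` embeds them into `Fin k`.
length-untwinned≤ : (g : Fin m → Fin k) (xs : List (Fin m)) → Unique xs →
  length (filter (∁? (twinned? g)) xs) ≤ k
length-untwinned≤ g xs xs! = injective⇒≤ g∘lookup-injective
  where
  ys = filter (∁? (twinned? g)) xs
  g∘lookup-injective : ∀ {i j} → g (lookup ys i) ≡ g (lookup ys j) → i ≡ j
  g∘lookup-injective {i} {j} eq with lookup ys i ≟ lookup ys j
  ... | yes p = lookup-injective (filter⁺ (∁? (twinned? g)) xs!) p
  ... | no ¬p = contradiction (lookup ys j , ¬p , eq)
                  (All.lookup (all-filter (∁? (twinned? g)) xs) (∈-lookup i))

length≤twinned+k : (g : Fin m → Fin k) (xs : List (Fin m)) → Unique xs →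
  length xs ≤ length (filter (twinned? g) xs) + k
length≤twinned+k g xs xs! = ≤-trans (≤-reflexive (length-filter-∁ (twinned? g) xs))
  (+-monoʳ-≤ _ (length-untwinned≤ g xs xs!))

commonly-twinned : (gs : List (Fin m → Fin k)) (xs : List (Fin m)) → Unique xs →
  length gs * k < length xs → ∃ λ i → i ∈ᴸ xs × All (λ g → Twinned g i) gs
commonly-twinned [] (x ∷ xs) xs! _ = x , here refl , []
commonly-twinned {k = k} (g ∷ gs) xs xs! lt
  -- Filtering by `g` loses at most `k` elements, which the summand `k` split off from
  -- `length (g ∷ gs) * k` pays for.
  with commonly-twinned gs (filter (twinned? g) xs) (filter⁺ (twinned? g) xs!)
         (+-cancelʳ-< k _ _ (<-≤-trans (subst (_< length xs) (+-comm k _) lt) (length≤twinned+k g xs xs!)))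
... | i , i∈ , twins with ∈-filter⁻ (twinned? g) {xs = xs} i∈
...   | i∈xs , twin = i , i∈xs , twin ∷ twins

-- Subsets of finite sets

subset : {P : Fin n → Set} → Decidable P → Subset n
subset P? = Vec.tabulate (does ∘ P?)

∈-subset⁻ : ∀ {n} {P : Fin n → Set} (P? : Decidable P) {i} → i ∈ subset P? → P i
∈-subset⁻ {suc n} P? {zero} i∈ with P? zero | i∈
... | yes p | _  = p
... | no _  | ()
∈-subset⁻ {suc n} P? {suc i} (there i∈) = ∈-subset⁻ (P? ∘ suc) i∈

-- The map `f` is arbitrary because the induction passes to `f ∘ suc`; the case of interest is
-- `f = id`.
∣subset∣ : {P : A → Set} (P? : Decidable P) (f : Fin n → A) →
  ∣ subset (P? ∘ f) ∣ ≡ length (filter P? (tabulate f))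
∣subset∣ {n = zero}  P? f = refl
∣subset∣ {n = suc n} P? f with does (P? (f zero))
... | true  = cong suc (∣subset∣ P? (f ∘ suc))
... | false = ∣subset∣ P? (f ∘ suc)

∣p∪q∣≤∣p∣+∣q∣ : (p q : Subset n) → ∣ p ∪ q ∣ ≤ ∣ p ∣ + ∣ q ∣
∣p∪q∣≤∣p∣+∣q∣ [] [] = z≤n
∣p∪q∣≤∣p∣+∣q∣ (outside ∷ p) (outside ∷ q) = ∣p∪q∣≤∣p∣+∣q∣ p q
∣p∪q∣≤∣p∣+∣q∣ (outside ∷ p) (inside  ∷ q) = ≤-trans (s≤s (∣p∪q∣≤∣p∣+∣q∣ p q)) (≤-reflexive (sym (+-suc _ _)))
∣p∪q∣≤∣p∣+∣q∣ (inside  ∷ p) (outside ∷ q) = s≤s (∣p∪q∣≤∣p∣+∣q∣ p q)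
∣p∪q∣≤∣p∣+∣q∣ (inside  ∷ p) (inside  ∷ q) = s≤s (≤-trans (∣p∪q∣≤∣p∣+∣q∣ p q) (+-monoʳ-≤ _ (n≤1+n _)))

∣⁅x⁆∪⁅y⁆∣≡2 : {x y : Fin n} → x ≢ y → ∣ ⁅ x ⁆ ∪ ⁅ y ⁆ ∣ ≡ 2
∣⁅x⁆∪⁅y⁆∣≡2 {x = zero}  {zero}  x≢y = contradiction refl x≢y
∣⁅x⁆∪⁅y⁆∣≡2 {x = zero}  {suc y} x≢y = cong suc (trans (cong ∣_∣ (∪-identityˡ ⁅ y ⁆)) (∣⁅x⁆∣≡1 y))
∣⁅x⁆∪⁅y⁆∣≡2 {x = suc x} {zero}  x≢y = cong suc (trans (cong ∣_∣ (∪-identityʳ ⁅ x ⁆)) (∣⁅x⁆∣≡1 x))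
∣⁅x⁆∪⁅y⁆∣≡2 {x = suc x} {suc y} x≢y = ∣⁅x⁆∪⁅y⁆∣≡2 (x≢y ∘ cong suc)

∣p++q∣≡∣p∣+∣q∣ : (p : Subset m) (q : Subset n) → ∣ p ++ q ∣ ≡ ∣ p ∣ + ∣ q ∣
∣p++q∣≡∣p∣+∣q∣ []            q = refl
∣p++q∣≡∣p∣+∣q∣ (outside ∷ p) q = ∣p++q∣≡∣p∣+∣q∣ p q
∣p++q∣≡∣p∣+∣q∣ (inside  ∷ p) q = cong suc (∣p++q∣≡∣p∣+∣q∣ p q)

++-⊆ : {p p′ : Subset m} {q q′ : Subset n} → p ⊆ p′ → q ⊆ q′ → p ++ q ⊆ p′ ++ q′
++-⊆ {p = []} {[]} p⊆ q⊆ = q⊆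
++-⊆ {p = outside ∷ p} {s ∷ p′} p⊆ q⊆ (there i∈) = there (++-⊆ (drop-∷-⊆ p⊆) q⊆ i∈)
++-⊆ {p = inside ∷ p} {s ∷ p′} p⊆ q⊆ (there i∈) = there (++-⊆ (drop-∷-⊆ p⊆) q⊆ i∈)
++-⊆ {p = inside ∷ p} {s ∷ p′} p⊆ q⊆ here with p⊆ here
... | here = here

data Split++ (p : Subset m) (q : Subset n) : Fin (m + n) → Set where
  left  : ∀ {i} → i ∈ p → Split++ p q (i ↑ˡ n)
  right : ∀ {j} → j ∈ q → Split++ p q (m ↑ʳ j)

split++ : (p : Subset m) (q : Subset n) {i : Fin (m + n)} → i ∈ p ++ q → Split++ p q i
split++ []      q i∈ = right i∈
split++ (_ ∷ p) q here = left here
split++ (_ ∷ p) q (there i∈) with split++ p q i∈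
... | left  i∈p = left (there i∈p)
... | right j∈q = right j∈q

interpolate : {p q : Subset n} (s : ℕ) → p ⊆ q → ∣ p ∣ ≤ s → s ≤ ∣ q ∣ →
  ∃ λ t → p ⊆ t × t ⊆ q × ∣ t ∣ ≡ s
interpolate {p = []} {[]} zero p⊆q _ _ = [] , id , id , refl
interpolate {p = inside ∷ p} {outside ∷ q} s p⊆q _ _ with () ← p⊆q here
interpolate {p = inside ∷ p} {inside ∷ q} (suc s) p⊆q (s≤s l) (s≤s u)
  with interpolate s (drop-∷-⊆ p⊆q) l u
... | t , p⊆t , t⊆q , ∣t∣ = inside ∷ t , in⊆in p⊆t , in⊆in t⊆q , cong suc ∣t∣
interpolate {p = outside ∷ p} {outside ∷ q} s p⊆q l u
  with interpolate s (drop-∷-⊆ p⊆q) l u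
... | t , p⊆t , t⊆q , ∣t∣ = outside ∷ t , out⊆ p⊆t , out⊆ t⊆q , ∣t∣
interpolate {p = outside ∷ p} {inside ∷ q} s p⊆q l u with m≤n⇒m<n∨m≡n u
-- If `s` is the full size of the upper set, that set is the answer; otherwise its first element can
-- be spared.
... | inj₂ refl = inside ∷ q , p⊆q , id , refl
... | inj₁ (s≤s u′) with interpolate s (drop-∷-⊆ p⊆q) l u′
...   | t , p⊆t , t⊆q , ∣t∣ = outside ∷ t , out⊆ p⊆t , out⊆ t⊆q , ∣t∣

-- Enumerating the subsets of a given size

subsetsOfSize : ℕ → Subset n → List (Subset n)
subsetsOfSize zero    p             = ⊥ ∷ []
subsetsOfSize (suc r) []            = []
subsetsOfSize (suc r) (outside ∷ p) = map (outside ∷_) (subsetsOfSize (suc r) p)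
subsetsOfSize (suc r) (inside  ∷ p) =
  map (inside ∷_) (subsetsOfSize r p) List.++ map (outside ∷_) (subsetsOfSize (suc r) p)

out-edge : ∀ {r s} {e p : Subset n} → ∣ e ∣ ≡ r × e ⊆ p → ∣ outside ∷ e ∣ ≡ r × outside ∷ e ⊆ s ∷ p
out-edge (∣e∣ , e⊆p) = ∣e∣ , out⊆ e⊆p

in-edge : ∀ {r} {e p : Subset n} → ∣ e ∣ ≡ r × e ⊆ p → ∣ inside ∷ e ∣ ≡ suc r × inside ∷ e ⊆ inside ∷ p
in-edge (∣e∣ , e⊆p) = cong suc ∣e∣ , in⊆in e⊆p

subsetsOfSize-correct : (r : ℕ) (p : Subset n) → All (λ e → ∣ e ∣ ≡ r × e ⊆ p) (subsetsOfSize r p)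
subsetsOfSize-correct {n} zero p            = (∣⊥∣≡0 n , ⊥⊆) ∷ []
subsetsOfSize-correct (suc r) []            = []
subsetsOfSize-correct (suc r) (outside ∷ p) =
  All-map⁺ (All.map out-edge (subsetsOfSize-correct (suc r) p))
subsetsOfSize-correct (suc r) (inside ∷ p)  = All-++⁺
  (All-map⁺ (All.map in-edge (subsetsOfSize-correct r p)))
  (All-map⁺ (All.map out-edge (subsetsOfSize-correct (suc r) p)))

subsetsOfSize-unique : (r : ℕ) (p : Subset n) → Unique (subsetsOfSize r p)
subsetsOfSize-unique zero    p             = [] ∷ []
subsetsOfSize-unique (suc r) []            = []
subsetsOfSize-unique (suc r) (outside ∷ p) = map⁺ ∷-injectiveʳ (subsetsOfSize-unique (suc r) p)
subsetsOfSize-unique (suc r) (inside  ∷ p) = ++⁺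
  (map⁺ ∷-injectiveʳ (subsetsOfSize-unique r p))
  (map⁺ ∷-injectiveʳ (subsetsOfSize-unique (suc r) p))
  λ (v∈₁ , v∈₂) → disjoint (∈-map⁻ (inside ∷_) v∈₁) (∈-map⁻ (outside ∷_) v∈₂)
  where
  disjoint : ∀ {v xs ys} → (∃ λ x → x ∈ᴸ xs × v ≡ inside ∷ x) → ¬ (∃ λ y → y ∈ᴸ ys × v ≡ outside ∷ y)
  disjoint (_ , _ , refl) (_ , _ , ())

length-subsetsOfSize : (r : ℕ) (p : Subset n) → length (subsetsOfSize r p) ≡ ∣ p ∣ C r
length-subsetsOfSize zero    p             = refl
length-subsetsOfSize (suc r) []            = refl
length-subsetsOfSize (suc r) (outside ∷ p) =
  trans (length-map (outside ∷_) (subsetsOfSize (suc r) p)) (length-subsetsOfSize (suc r) p)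
length-subsetsOfSize (suc r) (inside ∷ p)  = begin
  length (map (inside ∷_) es₁ List.++ map (outside ∷_) es₂) ≡⟨ length-++ (map (inside ∷_) es₁) ⟩
  length (map (inside ∷_) es₁) + length (map (outside ∷_) es₂)
    ≡⟨ cong₂ _+_ (length-map (inside ∷_) es₁) (length-map (outside ∷_) es₂) ⟩
  length es₁ + length es₂ ≡⟨ cong₂ _+_ (length-subsetsOfSize r p) (length-subsetsOfSize (suc r) p) ⟩
  ∣ p ∣ C r + ∣ p ∣ C suc r ≡⟨ nCk+nC[k+1]≡[n+1]C[k+1] ∣ p ∣ r ⟩
  suc ∣ p ∣ C suc r ∎
  where
  open ≡-Reasoning
  es₁ = subsetsOfSize r p
  es₂ = subsetsOfSize (suc r) p

-- Lower bounds for binomial coefficients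

nCk≤[d+n]Ck : ∀ d n k → n C k ≤ (d + n) C k
nCk≤[d+n]Ck zero    n k       = ≤-refl
nCk≤[d+n]Ck (suc d) n zero    = ≤-refl
nCk≤[d+n]Ck (suc d) n (suc k) = ≤-trans (nCk≤[d+n]Ck d n (suc k))
  (≤-trans (m≤n+m _ ((d + n) C k)) (≤-reflexive (nCk+nC[k+1]≡[n+1]C[k+1] (d + n) k)))

-- Climbing from `n` to `q + n` by Pascal's rule takes `q` steps, and each adds at least `n C k`.
q*nCk≤[q+n]C[k+1] : ∀ q n k → q * (n C k) ≤ (q + n) C suc k
q*nCk≤[q+n]C[k+1] zero    n k = z≤n
q*nCk≤[q+n]C[k+1] (suc q) n k = ≤-trans
  (+-mono-≤ (nCk≤[d+n]Ck q n k) (q*nCk≤[q+n]C[k+1] q n k))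
  (≤-reflexive (nCk+nC[k+1]≡[n+1]C[k+1] (q + n) k))

-- Combinatorially, one element is chosen from each of `k` blocks of size `q`. This form of the
-- bound involves no factorials.
q^k≤[k*q]Ck : ∀ q k → q ^ k ≤ (k * q) C k
q^k≤[k*q]Ck q zero    = ≤-refl
q^k≤[k*q]Ck q (suc k) = ≤-trans (*-monoʳ-≤ q (q^k≤[k*q]Ck q k)) (q*nCk≤[q+n]C[k+1] q (k * q) k)

-- Repeated colours

Repeats : ℕ → EdgeColoring n k → Subset n → Set
Repeats r f T =
  ∃₂ λ e e′ → (IsEdge r e × e ⊆ T) × (IsEdge r e′ × e′ ⊆ T) × e ≢ e′ × f e ≡ f e′

Repeats-mono : ∀ {r} {f : EdgeColoring n k} {S T : Subset n} → S ⊆ T → Repeats r f S → Repeats r f T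
Repeats-mono S⊆T (e , e′ , (∣e∣ , e⊆) , (∣e′∣ , e′⊆) , rest) =
  e , e′ , (∣e∣ , S⊆T ∘ e⊆) , (∣e′∣ , S⊆T ∘ e′⊆) , rest

Repeats⇒¬Rainbow : ∀ {r} {f : EdgeColoring n k} {T : Subset n} → Repeats r f T → ¬ Rainbow r f T
Repeats⇒¬Rainbow (e , e′ , (∣e∣ , e⊆) , (∣e′∣ , e′⊆) , e≢e′ , eq) rainbow =
  e≢e′ (rainbow e e′ ∣e∣ ∣e′∣ e⊆ e′⊆ eq)

-- All the repetitions share one edge, which keeps the set small.
repeats-in-small-set : (r : ℕ) (S : Subset n) (fs : List (EdgeColoring n k)) →
  length fs * k < ∣ S ∣ C r →
  ∃ λ B → B ⊆ S × ∣ B ∣ ≤ suc (length fs) * r × All (λ f → Repeats r f B) fs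
repeats-in-small-set {n} {k} r S fs lt =
  let B , _ , rest = collect fs twins in B , rest
  where
  es = subsetsOfSize r S
  edge : Fin (length es) → Subset n
  edge = lookup es
  edge-correct : ∀ i → IsEdge r (edge i) × edge i ⊆ S
  edge-correct i = All.lookup (subsetsOfSize-correct r S) (∈-lookup i)

  -- Edges are replaced by their indices in `es`, so that the pigeonhole argument yields one edge
  -- `edge i` whose colour recurs under every colouring in `fs`.
  common = commonly-twinned (map (_∘ edge) fs) (allFin (length es)) (allFin⁺ _)
    (subst₂ _<_ (cong (_* k) (sym (length-map (_∘ edge) fs)))
      (trans (sym (length-subsetsOfSize r S)) (sym (length-allFin _))) lt)
  i = proj₁ common
  twins = proj₂ (proj₂ common)

  -- Starting from `edge i`, each colouring adds one partner edge, hence the size bound of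
  -- `suc (length fs)` edges of `r` vertices.
  collect : (fs : List (EdgeColoring n k)) → All (λ g → Twinned g i) (map (_∘ edge) fs) →
    ∃ λ B → edge i ⊆ B × B ⊆ S × ∣ B ∣ ≤ suc (length fs) * r × All (λ f → Repeats r f B) fs
  collect [] [] = edge i , id , proj₂ (edge-correct i) ,
    ≤-reflexive (trans (proj₁ (edge-correct i)) (sym (+-identityʳ r))) , []
  collect (f ∷ fs) ((j , i≢j , eq) ∷ twins) with collect fs twins
  ... | B , i⊆B , B⊆S , ∣B∣≤ , reps =
    edge j ∪ B , q⊆p∪q (edge j) B ∘ i⊆B , ∪⊆S , ∣∪∣≤ ,
    (edge i , edge j , (proj₁ (edge-correct i) , q⊆p∪q (edge j) B ∘ i⊆B) ,
      (proj₁ (edge-correct j) , p⊆p∪q B) ,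
      i≢j ∘ lookup-injective (subsetsOfSize-unique r S) , eq)
    ∷ All.map (Repeats-mono (q⊆p∪q (edge j) B)) reps
    where
    ∪⊆S : edge j ∪ B ⊆ S
    ∪⊆S x∈ with x∈p∪q⁻ (edge j) B x∈
    ... | inj₁ x∈j = proj₂ (edge-correct j) x∈j
    ... | inj₂ x∈B = B⊆S x∈B
    ∣∪∣≤ : ∣ edge j ∪ B ∣ ≤ r + suc (length fs) * r
    ∣∪∣≤ = ≤-trans (∣p∪q∣≤∣p∣+∣q∣ (edge j) B)
      (+-mono-≤ (≤-reflexive (proj₁ (edge-correct j))) ∣B∣≤)

-- A pair of points on which many colourings agree

agree? : (h : Fin n → Fin m → Fin k) (x y : Fin m) (u : Fin n) → Dec (x ≢ y × h u x ≡ h u y)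
agree? h x y u = ¬? (x ≟ y) ×-dec (h u x ≟ h u y)

-- Averaging twice: some `x` is twinned for at least half of all `u`, and among those `u` some `y`
-- is the partner of `x` for at least a fraction 1/(2k).
popular-pair : .{{_ : NonZero k}} (h : Fin n → Fin (2 * k) → Fin k) →
  ∃₂ λ x y → n ≤ 4 * k * ∣ subset (agree? h x y) ∣
popular-pair {k = k@(suc _)} {n} h = x , y , *-cancelʳ-≤ n _ k (begin
  n * k                                  ≡⟨ cong (_* k) (sym (length-allFin n)) ⟩
  length us * k                          ≤⟨ proj₂ first ⟩
  length xs * length twinnedAt           ≡⟨ cong (_* length twinnedAt) (length-allFin (2 * k)) ⟩
  2 * k * length twinnedAt               ≡⟨ cong (2 * k *_) (sym (*-identityʳ _)) ⟩
  2 * k * (length twinnedAt * 1)         ≤⟨ *-monoʳ-≤ (2 * k) (proj₂ second) ⟩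
  2 * k * (length xs * length (filter (agree? h x y) twinnedAt))
    ≤⟨ *-monoʳ-≤ (2 * k) (*-monoʳ-≤ (length xs) (length-mono-≤
         (filter⁺-⊆ (agree? h x y) (agree? h x y) (λ { refl → id }) (filter-⊆ (λ u → twinned? (h u) x) us)))) ⟩
  2 * k * (length xs * length (filter (agree? h x y) us))
    ≡⟨ cong₂ (λ a b → 2 * k * (a * b)) (length-allFin (2 * k)) (sym (∣subset∣ (agree? h x y) id)) ⟩
  2 * k * (2 * k * ∣ subset (agree? h x y) ∣) ≡⟨ arith k ∣ subset (agree? h x y) ∣ ⟩
  4 * k * ∣ subset (agree? h x y) ∣ * k  ∎)
  where
  open ≤-Reasoning
  us = allFin n
  xs = allFin (2 * k)
  -- With `2 * k` points and `k` colours, at most `k` points are untwinned, so every `u` sees at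
  -- least `k` twinned ones.
  first = double-counting (λ x u → twinned? (h u) x) k zero (tabulate suc) us
    (All.universal (λ u → +-cancelʳ-≤ k k _ (begin
      k + k                                   ≡⟨ cong (k +_) (sym (+-identityʳ k)) ⟩
      2 * k                                   ≡⟨ sym (length-allFin (2 * k)) ⟩
      length xs                               ≤⟨ length≤twinned+k (h u) xs (allFin⁺ _) ⟩
      length (filter (twinned? (h u)) xs) + k ∎)) us)
  x = proj₁ first
  twinnedAt = filter (λ u → twinned? (h u) x) us
  -- The weight is 1, since each remaining `u` guarantees just one partner of `x`.
  second = double-counting (agree? h x) 1 zero (tabulate suc) twinnedAt
    (All.map (λ { {u} (y , p) → filter-some (λ y → agree? h x y u) (lose (∈-allFin y) p) })
      (all-filter (λ u → twinned? (h u) x) us))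
  y = proj₁ second
  arith : ∀ k s → 2 * k * (2 * k * s) ≡ 4 * k * s * k
  arith = solve-∀

-- Hubs and rims: the vertex set Fin (t + (m + n)) consists of Q, X and U, in this order.

fan : (t m : ℕ) → Fin m → Fin n → Subset (t + (m + n))
fan t m x u = ⊤ {n = t} ++ (⁅ x ⁆ ++ ⁅ u ⁆)

∣fan∣ : (t m : ℕ) (x : Fin m) (u : Fin n) → ∣ fan t m x u ∣ ≡ 2 + t
∣fan∣ t m x u = begin
  ∣ fan t m x u ∣                        ≡⟨ ∣p++q∣≡∣p∣+∣q∣ (⊤ {n = t}) _ ⟩
  ∣ ⊤ {n = t} ∣ + ∣ ⁅ x ⁆ ++ ⁅ u ⁆ ∣      ≡⟨ cong₂ _+_ (∣⊤∣≡n t) (∣p++q∣≡∣p∣+∣q∣ ⁅ x ⁆ ⁅ u ⁆) ⟩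
  t + (∣ ⁅ x ⁆ ∣ + ∣ ⁅ u ⁆ ∣)             ≡⟨ cong (t +_) (cong₂ _+_ (∣⁅x⁆∣≡1 x) (∣⁅x⁆∣≡1 u)) ⟩
  t + 2                                  ≡⟨ +-comm t 2 ⟩
  2 + t                                  ∎
  where open ≡-Reasoning

⁅⁆-injective : {x y : Fin n} → ⁅ x ⁆ ≡ ⁅ y ⁆ → x ≡ y
⁅⁆-injective {x = x} {y} eq = x∈⁅y⁆⇒x≡y y (subst (x ∈_) eq (x∈⁅x⁆ x))

⁅⁆-⊆ : {x : Fin n} {p : Subset n} → x ∈ p → ⁅ x ⁆ ⊆ p
⁅⁆-⊆ {x = x} {p} x∈p y∈ = subst (_∈ p) (sym (x∈⁅y⁆⇒x≡y x y∈)) x∈p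

fan-injectiveˡ : (t m : ℕ) {x y : Fin m} {u : Fin n} → fan t m x u ≡ fan t m y u → x ≡ y
fan-injectiveˡ t m {x} {y} eq =
  ⁅⁆-injective (++-injectiveˡ ⁅ x ⁆ ⁅ y ⁆ (++-injectiveʳ (⊤ {n = t}) ⊤ eq))

rimEdge : (t m : ℕ) → Subset n → Subset (t + (m + n))
rimEdge t m e = ⊥ {n = t} ++ (⊥ {n = m} ++ e)

∣rimEdge∣ : (t m : ℕ) (e : Subset n) → ∣ rimEdge t m e ∣ ≡ ∣ e ∣
∣rimEdge∣ t m e = begin
  ∣ rimEdge t m e ∣                      ≡⟨ ∣p++q∣≡∣p∣+∣q∣ (⊥ {n = t}) _ ⟩
  ∣ ⊥ {n = t} ∣ + ∣ ⊥ {n = m} ++ e ∣      ≡⟨ cong₂ _+_ (∣⊥∣≡0 t) (∣p++q∣≡∣p∣+∣q∣ (⊥ {n = m}) e) ⟩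
  ∣ ⊥ {n = m} ∣ + ∣ e ∣                   ≡⟨ cong (_+ ∣ e ∣) (∣⊥∣≡0 m) ⟩
  ∣ e ∣                                  ∎
  where open ≡-Reasoning

rimEdge-injective : (t m : ℕ) {e e′ : Subset n} → rimEdge t m e ≡ rimEdge t m e′ → e ≡ e′
rimEdge-injective t m eq = ++-injectiveʳ (⊥ {n = m}) ⊥ (++-injectiveʳ (⊥ {n = t}) ⊥ eq)

-- The vertices Q ∪ {x, y} are kept as a list, because each of them contributes one colouring to be
-- spoiled.
hub : (t m n : ℕ) → Fin m → Fin m → List (Fin (t + (m + n)))
hub t m n x y = tabulate {n = t} (_↑ˡ (m + n)) List.++ (t ↑ʳ (x ↑ˡ n)) ∷ (t ↑ʳ (y ↑ˡ n)) ∷ []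

length-hub : (t m n : ℕ) (x y : Fin m) → length (hub t m n x y) ≡ 2 + t
length-hub t m n x y = begin
  length (hub t m n x y)                ≡⟨ length-++ spokes ⟩
  length spokes + 2                     ≡⟨ cong (_+ 2) (length-tabulate {n = t} (_↑ˡ (m + n))) ⟩
  t + 2                                 ≡⟨ +-comm t 2 ⟩
  2 + t                                 ∎
  where
  open ≡-Reasoning
  spokes : List (Fin (t + (m + n)))
  spokes = tabulate {n = t} (_↑ˡ (m + n))

wheel : (t m : ℕ) → Fin m → Fin m → Subset n → Subset (t + (m + n))
wheel t m x y R = ⊤ {n = t} ++ ((⁅ x ⁆ ∪ ⁅ y ⁆) ++ R)

∣wheel∣ : (t m : ℕ) {x y : Fin m} (R : Subset n) → x ≢ y → ∣ wheel t m x y R ∣ ≡ 2 + t + ∣ R ∣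
∣wheel∣ t m {x} {y} R x≢y = begin
  ∣ wheel t m x y R ∣                          ≡⟨ ∣p++q∣≡∣p∣+∣q∣ (⊤ {n = t}) _ ⟩
  ∣ ⊤ {n = t} ∣ + ∣ (⁅ x ⁆ ∪ ⁅ y ⁆) ++ R ∣      ≡⟨ cong₂ _+_ (∣⊤∣≡n t) (∣p++q∣≡∣p∣+∣q∣ (⁅ x ⁆ ∪ ⁅ y ⁆) R) ⟩
  t + (∣ ⁅ x ⁆ ∪ ⁅ y ⁆ ∣ + ∣ R ∣)               ≡⟨ cong (λ a → t + (a + ∣ R ∣)) (∣⁅x⁆∪⁅y⁆∣≡2 x≢y) ⟩
  t + (2 + ∣ R ∣)                              ≡⟨ x∙yz≈y∙xz t 2 ∣ R ∣ ⟩
  2 + t + ∣ R ∣                                ∎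
  where open ≡-Reasoning

rimEdge⊆wheel : (t m : ℕ) {x y : Fin m} {e R : Subset n} → e ⊆ R → rimEdge t m e ⊆ wheel t m x y R
rimEdge⊆wheel t m {x} {y} e⊆R =
  ++-⊆ {p = ⊥ {n = t}} {⊤} ⊥⊆ (++-⊆ {p = ⊥ {n = m}} {⁅ x ⁆ ∪ ⁅ y ⁆} ⊥⊆ e⊆R)

fan⊆wheel : (t m : ℕ) {x y z : Fin m} {u : Fin n} {R : Subset n} →
  z ∈ ⁅ x ⁆ ∪ ⁅ y ⁆ → u ∈ R → fan t m z u ⊆ wheel t m x y R
fan⊆wheel t m z∈ u∈ = ++-⊆ {p = ⊤ {n = t}} id (++-⊆ (⁅⁆-⊆ z∈) (⁅⁆-⊆ u∈))

fan-repeats : (t m : ℕ) (g : EdgeColoring (t + (m + n)) k) {x y : Fin m} {u : Fin n} {R : Subset n} →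
  x ≢ y → u ∈ R → g (fan t m x u) ≡ g (fan t m y u) → Repeats (2 + t) g (wheel t m x y R)
fan-repeats t m g {x} {y} {u} x≢y u∈R eq =
  fan t m x u , fan t m y u ,
  (∣fan∣ t m x u , fan⊆wheel t m (x∈p∪q⁺ (inj₁ (x∈⁅x⁆ x))) u∈R) ,
  (∣fan∣ t m y u , fan⊆wheel t m (x∈p∪q⁺ (inj₂ (x∈⁅x⁆ y))) u∈R) ,
  x≢y ∘ fan-injectiveˡ t m {u = u} , eq

rim-repeats : (t m : ℕ) {r : ℕ} (g : EdgeColoring (t + (m + n)) k) {x y : Fin m} {R : Subset n} →
  Repeats r (g ∘ rimEdge t m) R → Repeats r g (wheel t m x y R)
rim-repeats t m g (e , e′ , (∣e∣ , e⊆) , (∣e′∣ , e′⊆) , e≢e′ , eq) =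
  rimEdge t m e , rimEdge t m e′ ,
  (trans (∣rimEdge∣ t m e) ∣e∣ , rimEdge⊆wheel t m e⊆) ,
  (trans (∣rimEdge∣ t m e′) ∣e′∣ , rimEdge⊆wheel t m e′⊆) ,
  e≢e′ ∘ rimEdge-injective t m , eq

-- Separates the two kinds of vertices of a wheel, whose colourings fail to be rainbow for different
-- reasons.
wheel-elim : (t m : ℕ) {x y : Fin m} {R : Subset n} {P : Fin (t + (m + n)) → Set} →
  All P (hub t m n x y) → (∀ {u} → u ∈ R → P (t ↑ʳ (m ↑ʳ u))) →
  ∀ {v} → v ∈ wheel t m x y R → P v
wheel-elim {n} t m {x} {y} {R} onHub onRim v∈ with split++ (⊤ {n = t}) _ v∈
... | left {i} _ = All.lookup onHub (∈-++⁺ˡ (∈-tabulate⁺ {f = _↑ˡ (m + n)} i))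
... | right j∈ with split++ (⁅ x ⁆ ∪ ⁅ y ⁆) R j∈
...   | right u∈R = onRim u∈R
...   | left z∈ with x∈p∪q⁻ ⁅ x ⁆ ⁅ y ⁆ z∈
...     | inj₁ z∈x rewrite x∈⁅y⁆⇒x≡y x z∈x =
  All.lookup onHub (∈-++⁺ʳ (tabulate {n = t} (_↑ˡ (m + n))) (here refl))
...     | inj₂ z∈y rewrite x∈⁅y⁆⇒x≡y y z∈y =
  All.lookup onHub (∈-++⁺ʳ (tabulate {n = t} (_↑ˡ (m + n))) (there (here refl)))

-- Sets on which no colouring is rainbow

-- The bad set is a wheel with rim R ⊆ S. Rim vertices fail because two fans agree; the r hub
-- vertices fail because R contains a set B spoiling all their colourings.
fans-agreeing⇒¬local : (t m : ℕ) {p : ℕ} (f : Fin (t + (m + n)) → EdgeColoring (t + (m + n)) k)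
  {x y : Fin m} → x ≢ y → (S : Subset n) →
  (∀ {u} → u ∈ S → f (t ↑ʳ (m ↑ʳ u)) (fan t m x u) ≡ f (t ↑ʳ (m ↑ʳ u)) (fan t m y u)) →
  (2 + t) + (3 + t) * (2 + t) ≤ p → p ≤ ∣ S ∣ → (2 + t) * k < ∣ S ∣ C (2 + t) →
  ¬ IsLocalColoring (t + (m + n)) (2 + t) p k f
fans-agreeing⇒¬local {n} {k} t m {p} f {x} {y} x≢y S agree p≥ p≤∣S∣ many local =
  fromSmall (repeats-in-small-set r S fs (subst (λ l → l * k < ∣ S ∣ C r) (sym length-fs) many))
  where
  r = 2 + t
  -- The colourings of the hub vertices, restricted to edges inside U.
  fs : List (EdgeColoring n k)
  fs = map (λ v → f v ∘ rimEdge t m) (hub t m n x y)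
  length-fs : length fs ≡ r
  length-fs = trans (length-map (λ v → f v ∘ rimEdge t m) (hub t m n x y)) (length-hub t m n x y)
  r≤p : r ≤ p
  r≤p = m+n≤o⇒m≤o r p≥

  fromPadded : ∀ {B R} → All (λ g → Repeats r g B) fs → B ⊆ R → R ⊆ S → ∣ R ∣ ≡ p ∸ r → Empty.⊥
  fromPadded {B} {R} reps B⊆R R⊆S ∣R∣ with local (wheel t m x y R)
    (trans (∣wheel∣ t m R x≢y) (trans (cong (r +_) ∣R∣) (m+[n∸m]≡n r≤p)))
  ... | v , v∈ , rainbow = wheel-elim t m {P = λ v → ¬ Rainbow r (f v) (wheel t m x y R)}
    (All.map (λ {v} rep → Repeats⇒¬Rainbow (rim-repeats t m (f v) (Repeats-mono B⊆R rep))) (All-map⁻ reps))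
    (λ {u} u∈R → Repeats⇒¬Rainbow (fan-repeats t m (f (t ↑ʳ (m ↑ʳ u))) x≢y u∈R (agree (R⊆S u∈R))))
    v∈ rainbow

  fromSmall : (∃ λ B → B ⊆ S × ∣ B ∣ ≤ suc (length fs) * r × All (λ g → Repeats r g B) fs) → Empty.⊥
  fromSmall (B , B⊆S , ∣B∣≤ , reps)
    -- The hub takes `r` of the `p` vertices, so the rim must have exactly `p ∸ r`; the lower bound
    -- on `p` leaves room for the (r + 1)r vertices that B may use.
    with interpolate (p ∸ r) B⊆S
      (≤-trans (subst (λ l → ∣ B ∣ ≤ suc l * r) length-fs ∣B∣≤)
        (m+n≤o⇒m≤o∸n (suc r * r) (≤-trans (≤-reflexive (+-comm (suc r * r) r)) p≥)))
      (≤-trans (m∸n≤m p r) p≤∣S∣)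
  ... | R , B⊆R , R⊆S , ∣R∣ = fromPadded reps B⊆R R⊆S ∣R∣

-- Here `n` counts only the vertices of U. The popular pair gives |S| ≥ rq, hence at least `q ^ r`
-- edges in S, more than the `r * k` that the pigeonhole needs.
many-vertices⇒¬colorable : (t : ℕ) .{{_ : NonZero k}} {p q : ℕ} →
  (2 + t) + (3 + t) * (2 + t) ≤ p → p ≤ q → (2 + t) * k < q ^ (2 + t) →
  4 * k * ((2 + t) * q) ≤ n → ¬ LocallyColorable (t + (2 * k + n)) (2 + t) p k
many-vertices⇒¬colorable {k} {n} t {p} {q} p≥ p≤q rk<q^r n≥ (f , local) = fromPair (popular-pair h)
  where
  r = 2 + t
  h : Fin n → Fin (2 * k) → Fin k
  h u x = f (t ↑ʳ (2 * k ↑ʳ u)) (fan t (2 * k) x u)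

  fromPair : ¬ (∃₂ λ x y → n ≤ 4 * k * ∣ subset (agree? h x y) ∣)
  fromPair (x , y , n≤) =
    fans-agreeing⇒¬local t (2 * k) f x≢y S (proj₂ ∘ agree) p≥ p≤∣S∣ (<-≤-trans rk<q^r q^r≤) local
    where
    S : Subset n
    S = subset (agree? h x y)
    agree : ∀ {u} → u ∈ S → x ≢ y × h u x ≡ h u y
    agree = ∈-subset⁻ (agree? h x y)
    rq≤∣S∣ : r * q ≤ ∣ S ∣
    rq≤∣S∣ = *-cancelˡ-≤ (4 * k) {{m*n≢0 4 k}} (≤-trans n≥ n≤)
    p≤∣S∣ : p ≤ ∣ S ∣
    p≤∣S∣ = ≤-trans p≤q (≤-trans (m≤n*m q r) rq≤∣S∣)
    q^r≤ : q ^ r ≤ ∣ S ∣ C r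
    q^r≤ = ≤-trans (q^k≤[k*q]Ck q r) (subst (λ s → (r * q) C r ≤ s C r) (m∸n+n≡m rq≤∣S∣)
      (nCk≤[d+n]Ck (∣ S ∣ ∸ r * q) (r * q) r))
    -- Distinctness is part of `agree?`, so any element of S provides it, and S is non-empty because
    -- its size is at least `p`.
    x≢y : x ≢ y
    x≢y with nonempty? S
    ... | yes (_ , u∈S) = proj₁ (agree u∈S)
    ... | no empty = contradiction
      (≤-trans (≤-trans p≥ p≤∣S∣) (≤-reflexive (trans (cong ∣_∣ (Empty-unique empty)) (∣⊥∣≡0 n))))
      λ ()

-- Bounding the number of vertices by the number of colours

^-distribʳ-* : ∀ a b r → (a * b) ^ r ≡ a ^ r * b ^ r
^-distribʳ-* a b zero    = refl
^-distribʳ-* a b (suc r) rewrite ^-distribʳ-* a b r = arith a b (a ^ r) (b ^ r)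
  where
  arith : ∀ a b c d → a * b * (c * d) ≡ a * c * (b * d)
  arith = solve-∀

-- Eliminates `l`: the exponent r + 1 consists of r factors `k` from the power and one more from
-- `l ^ r ≤ c * k`.
m≤n*[k*l]⇒m^r≤ : ∀ r m n k l c → m ≤ n * (k * l) → l ^ r ≤ c * k → m ^ r ≤ n ^ r * c * k ^ (r + 1)
m≤n*[k*l]⇒m^r≤ r m n k l c m≤ l^r≤ = begin
  m ^ r                         ≤⟨ ^-monoˡ-≤ r m≤ ⟩
  (n * (k * l)) ^ r             ≡⟨ ^-distribʳ-* n (k * l) r ⟩
  n ^ r * (k * l) ^ r           ≡⟨ cong (n ^ r *_) (^-distribʳ-* k l r) ⟩
  n ^ r * (k ^ r * l ^ r)       ≤⟨ *-monoʳ-≤ (n ^ r) (*-monoʳ-≤ (k ^ r) l^r≤) ⟩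
  n ^ r * (k ^ r * (c * k))     ≡⟨ arith (n ^ r) (k ^ r) c k ⟩
  n ^ r * c * (k ^ r * (k * 1)) ≡⟨ cong (n ^ r * c *_) (sym (^-distribˡ-+-* k r 1)) ⟩
  n ^ r * c * k ^ (r + 1)       ∎
  where
  open ≤-Reasoning
  arith : ∀ a b c d → a * (b * (c * d)) ≡ a * c * (b * (d * 1))
  arith = solve-∀

m<[1+m/n]*n : ∀ m n .{{_ : NonZero n}} → m < suc (m / n) * n
m<[1+m/n]*n m n = begin-strict
  m                   ≡⟨ m≡m%n+[m/n]*n m n ⟩
  m % n + m / n * n   <⟨ +-monoˡ-< (m / n * n) (m%n<n m n) ⟩
  suc (m / n) * n     ∎
  where open ≤-Reasoning

colorable⇒n^r≤ : (t p n k : ℕ) .{{_ : NonZero k}} → (2 + t) + (3 + t) * (2 + t) ≤ p →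
  LocallyColorable n (2 + t) p k →
  n ^ (2 + t) ≤ (p * (5 * (2 + t))) ^ (2 + t) * (2 + t) * k ^ (2 + t + 1)
colorable⇒n^r≤ t p n k@(suc _) p≥ col = bound (p ≤? q) (q ^ r ≤? r * k)
  where
  open ≤-Reasoning
  r = 2 + t
  -- Of the 5rkq vertices, 4rkq are for U, and the remaining rkq = tkq + 2kq cover the t + 2k
  -- reserved ones once q ≥ 1.
  D = 5 * r
  q = n / (D * k)
  n≤ : n ≤ suc q * (D * k)
  n≤ = <⇒≤ (m<[1+m/n]*n n (D * k))
  2≤p : 2 ≤ p
  2≤p = ≤-trans (s≤s (s≤s z≤n)) p≥

  -- The vertices outside the t + 2k reserved ones number at least 4k·rq.
  ¬dense : p ≤ q → ¬ r * k < q ^ r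
  ¬dense p≤q rk<q^r = many-vertices⇒¬colorable t p≥ p≤q rk<q^r (m+n≤o⇒m≤o∸n (4 * k * (r * q)) enough)
    (subst (λ n → LocallyColorable n r p k) split col)
    where
    k≤q*k : k ≤ q * k
    k≤q*k = m≤n*m k q {{>-nonZero (≤-trans (s≤s z≤n) (≤-trans 2≤p p≤q))}}
    enough : 4 * k * (r * q) + (t + 2 * k) ≤ n
    enough = begin
      4 * k * (r * q) + (t + 2 * k)             ≤⟨ +-monoʳ-≤ (4 * k * (r * q)) (+-mono-≤
                                                     (m≤m*n t (q * k) {{>-nonZero (≤-trans (s≤s z≤n) k≤q*k)}})
                                                     (*-monoʳ-≤ 2 k≤q*k)) ⟩
      4 * k * (r * q) + (t * (q * k) + 2 * (q * k)) ≡⟨ arith k q t ⟩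
      q * (D * k)                               ≤⟨ m/n*n≤m n (D * k) ⟩
      n                                         ∎
      where
      arith : ∀ k q t → 4 * k * ((2 + t) * q) + (t * (q * k) + 2 * (q * k)) ≡ q * (5 * (2 + t) * k)
      arith = solve-∀
    split : n ≡ t + (2 * k + (n ∸ (t + 2 * k)))
    split = trans (sym (m+[n∸m]≡n (m+n≤o⇒n≤o (4 * k * (r * q)) enough))) (+-assoc t (2 * k) _)

  bound : Dec (p ≤ q) → Dec (q ^ r ≤ r * k) → n ^ r ≤ (p * D) ^ r * r * k ^ (r + 1)
  -- When q < p, already n is at most a constant times k, and the elimination is applied with
  -- `l = 1`.
  bound (no p≰q) _ = m≤n*[k*l]⇒m^r≤ r n (p * D) k 1 r (begin
    n                     ≤⟨ n≤ ⟩
    suc q * (D * k)       ≤⟨ *-monoˡ-≤ (D * k) (≰⇒> p≰q) ⟩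
    p * (D * k)           ≡⟨ arith p D k ⟩
    p * D * (k * 1)       ∎)
    (≤-trans (≤-reflexive (^-zeroˡ r)) (s≤s z≤n))
    where
    arith : ∀ p D k → p * (D * k) ≡ p * D * (k * 1)
    arith = solve-∀
  bound (yes p≤q) (no q^r≰) = contradiction (≰⇒> q^r≰) (¬dense p≤q)
  bound (yes p≤q) (yes q^r≤) = m≤n*[k*l]⇒m^r≤ r n (p * D) k q r (begin
    n                     ≤⟨ n≤ ⟩
    suc q * (D * k)       ≤⟨ *-monoˡ-≤ (D * k) 1+q≤p*q ⟩
    p * q * (D * k)       ≡⟨ arith p q D k ⟩
    p * D * (k * q)       ∎)
    q^r≤
    where
    -- The rounding error in `q` is absorbed into the factor `p`, using 1 ≤ q and 2 ≤ p.
    1+q≤p*q : suc q ≤ p * q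
    1+q≤p*q = begin
      1 + q               ≤⟨ +-monoˡ-≤ q (≤-trans (<⇒≤ 2≤p) p≤q) ⟩
      q + q               ≡⟨ cong (q +_) (sym (+-identityʳ q)) ⟩
      2 * q               ≤⟨ *-monoˡ-≤ q 2≤p ⟩
      p * q               ∎
    arith : ∀ p q D k → p * q * (D * k) ≡ p * D * (k * q)
    arith = solve-∀

-- The conclusion is k ≥ (n^r / c)^(1/(r+1)) with the root cleared; `c` depends only on `r` and `p`.
theorem1p6 : ∀ (r p : ℕ) → 2 ≤ r → (2 * r ∸ 1) * r + 2 * (r ∸ 1) ≤ p →
    ∃ λ (c : ℕ) → 1 ≤ c × ∃ λ (N : ℕ) → ∀ (n k : ℕ) → N ≤ n →
    LocallyColorable n r p k → n ^ r ≤ c * k ^ (r + 1)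
theorem1p6 r@(suc (suc t)) p@(suc _) (s≤s (s≤s z≤n)) p≥ =
  (p * (5 * r)) ^ r * r , c≥1 , 1 , bound
  where
  c≥1 : 1 ≤ (p * (5 * r)) ^ r * r
  c≥1 = *-mono-≤ (m^n>0 (p * (5 * r)) r) (s≤s z≤n)
  -- (2r - 1)r + 2(r - 1) = r + (r + 1)r + (r - 2)(r + 1), with t = r - 2.
  arith : ∀ t → suc (t + (2 + (t + 0))) * (2 + t) + 2 * suc t ≡ 2 + t + (3 + t) * (2 + t) + t * (3 + t)
  arith = solve-∀
  p≥′ : r + (3 + t) * r ≤ p
  p≥′ = ≤-trans (m≤m+n _ (t * (3 + t))) (≤-trans (≤-reflexive (sym (arith t))) p≥)
  bound : ∀ n k → 1 ≤ n → LocallyColorable n r p k → n ^ r ≤ (p * (5 * r)) ^ r * r * k ^ (r + 1)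
  -- A vertex exists since `N = 1`, and its colouring would take a value in `Fin 0`.
  bound (suc n) zero    _ (f , _) with () ← f zero ⊥
  bound n       (suc k) _ col     = colorable⇒n^r≤ t p n (suc k) p≥′ col
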